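{- Let $C$ be a non-redundant sorting network on $n$ channels. Then every comparator in the last layer of $C$ is of the form $(i,i+1)$.
   Context: A comparator network on $n$ channels is a finite sequence $C=L_1,\ldots,L_d$ of layers, where each layer is a non-empty set of pairs (comparators) $(i,j)$ with $1\le i<j\le n$, and any two distinct comparators in the same layer are disjoint as sets of channels; $d$ is its depth. Inputs are Boolean vectors $\vec x\in\{0,1\}^n$. The network acts by applying the layers in order: applying a layer interchanges the values on channels $i$ and $j$ for every comparator $(i,j)$ of the layer such that the current value on channel $i$ is larger than the one on channel $j$. $C(\vec x)$ denotes the output on $\vec x$. $C$ is a sorting network if $C(\vec x)$ is sorted in non-decreasing order for every $\vec x\in\{0,1\}^n$. A comparator $(i,j)$ in layer $L_k$ of $C$ is redundant if, for every input $\vec x\in\{0,1\}^n$, the value on channel $i$ just before layer $L_k$ is $\le$ the value on channel $j$ just before layer $L_k$. A sorting network with no redundant comparators is called non-redundant. -}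

module Defs where

open import Data.Bool.Base using (Bool; if_then_else_; _≤_)
open import Data.Bool.Properties using (_<?_)
open import Data.Fin.Base using (Fin; toℕ) renaming (_<_ to _<ᶠ_)
open import Data.List.Base using (List; []; _∷_; foldl; length; take)
  renaming (lookup to layerAt)
open import Data.List.Membership.Propositional using (_∈_)
open import Data.List.Relation.Binary.Disjoint.Propositional using (Disjoint)
open import Data.List.Relation.Unary.AllPairs using (AllPairs)
open import Data.Nat.Base using (ℕ)
open import Data.Product.Base using (_×_)
open import Data.Vec.Base using (Vec; lookup; _[_]≔_)
open import Data.Vec.Relation.Unary.Linked using (Linked)
open import Relation.Binary.PropositionalEquality.Core using (_≢_)
open import Relation.Nullary using (¬_; does)

record Comparator (n : ℕ) : Set where
  constructor comparator
  field
    lo hi : Fin n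
    lo<hi : lo <ᶠ hi

open Comparator public

channels : ∀ {n} → Comparator n → List (Fin n)
channels c = lo c ∷ hi c ∷ []

-- A layer is a finite set of comparators, represented by a list.  Disjointness
-- of the entries at different positions also rules out repeated comparators.
record Layer (n : ℕ) : Set where
  constructor layer
  field
    comparators : List (Comparator n)
    nonEmpty    : comparators ≢ []
    disjoint    : AllPairs (λ c d → Disjoint (channels c) (channels d)) comparators

open Layer public

Network : ℕ → Set
Network n = List (Layer n)

applyComparator : ∀ {n} → Vec Bool n → Comparator n → Vec Bool n
applyComparator v c =
  if does (lookup v (hi c) <? lookup v (lo c))
  then v [ lo c ]≔ lookup v (hi c) [ hi c ]≔ lookup v (lo c)
  else v

-- The comparators of a layer act on disjoint channels, so applying them one
-- after the other is the same as applying them simultaneously.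
applyLayer : ∀ {n} → Vec Bool n → Layer n → Vec Bool n
applyLayer v L = foldl applyComparator v (comparators L)

run : ∀ {n} → Network n → Vec Bool n → Vec Bool n
run C x = foldl applyLayer x C

IsSorting : ∀ {n} → Network n → Set
IsSorting C = ∀ x → Linked _≤_ (run C x)

-- Layers are indexed from 0, so the first toℕ k layers are those before layer k.
valuesBefore : ∀ {n} (C : Network n) → Fin (length C) → Vec Bool n → Vec Bool n
valuesBefore C k x = run (take (toℕ k) C) x

Redundant : ∀ {n} (C : Network n) → Fin (length C) → Comparator n → Set
Redundant C k c =
  ∀ x → lookup (valuesBefore C k x) (lo c) ≤ lookup (valuesBefore C k x) (hi c)

IsNonRedundantSorting : ∀ {n} → Network n → Set
IsNonRedundantSorting C =
  IsSorting C × (∀ k c → c ∈ comparators (layerAt C k) → ¬ Redundant C k c)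

-- Suppose a comparator (i, j) of the last layer has i + 1 < j, and call an input x
-- inverted if just before that layer it has 1 on channel i and 0 on channel j.
-- Being inverted is invariant under exchanging a 1 and a 0 of x: lowering the 1 gives
-- u and raising the 0 gives v, both comparable with x and with the exchanged input y.
-- The outputs on x and y agree, so if y were not inverted it would have 0 on i and 1
-- on j.  By monotonicity u would then have 0 on both channels and v would have 1 on
-- both, so the sorted output on u is 0 up to j and the one on v is 1 from i on,
-- although they differ in only two entries.
-- Hence if x is inverted, so is the output C(x); but C(x) is sorted, and a comparator
-- network does not change sorted vectors.
module Submission where

open import Defs
open import Data.Bool.Base using (Bool; true; false; _∧_; _∨_; _≤_; f≤t; b≤b)
open import Data.Bool.Properties using (≤-minimum; ≤-maximum; ≤-refl; ≤-trans)
open import Data.Empty using (⊥-elim)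
open import Data.Fin.Base using (Fin; zero; suc; toℕ)
import Data.Fin.Properties as Fin
open import Data.List.Base using (List; []; _∷_; _∷ʳ_; foldl; last; take)
  renaming (lookup to layerAt)
open import Data.List.Membership.Propositional using (_∈_; _∉_)
open import Data.List.Properties using (foldl-∷ʳ)
open import Data.List.Relation.Binary.Disjoint.Propositional using (Disjoint)
open import Data.List.Relation.Unary.All using (All; []; _∷_)
import Data.List.Relation.Unary.All as All
open import Data.List.Relation.Unary.AllPairs using (AllPairs; _∷_)
open import Data.List.Relation.Unary.Any using (here; there)
open import Data.Maybe.Base using (just)
open import Data.Nat.Base using (ℕ; suc; z≤n; s≤s; _<_) renaming (_≤_ to _≤ⁿ_)
import Data.Nat.Properties as ℕ
open import Data.Product.Base using (_×_; _,_; proj₁; proj₂; ∃-syntax)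
open import Data.Sum.Base using (_⊎_; inj₁; inj₂)
open import Data.Vec.Base using (Vec; []; _∷_; lookup; _[_]≔_)
open import Data.Vec.Properties using (lookup∘update; lookup∘update′; []≔-lookup)
open import Data.Vec.Relation.Binary.Pointwise.Inductive using (Pointwise; []; _∷_)
import Data.Vec.Relation.Binary.Pointwise.Inductive as Pointwise
open import Data.Vec.Relation.Unary.Linked using (Linked; [-]; _∷_)
import Data.Vec.Relation.Unary.Linked as Linked
import Data.Vec.Relation.Unary.Linked.Properties as Linked
open import Function.Base using (_∘_)
open import Relation.Binary.PropositionalEquality
  using (_≡_; _≢_; refl; sym; trans; cong; cong₂; subst; subst₂; ≢-sym)
open import Relation.Nullary using (¬_; yes; no)

private
  variable
    n : ℕ
    x y : Vec Bool n

-- Booleans and the pointwise order on Boolean vectors.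

≤-or-inverted : ∀ a b → a ≤ b ⊎ (a ≡ true × b ≡ false)
≤-or-inverted false b     = inj₁ (≤-minimum b)
≤-or-inverted true  true  = inj₁ b≤b
≤-or-inverted true  false = inj₂ (refl , refl)

∧-mono-≤ : ∀ {a b c d} → a ≤ b → c ≤ d → a ∧ c ≤ b ∧ d
∧-mono-≤ f≤t           _ = ≤-minimum _
∧-mono-≤ (b≤b {false}) _ = b≤b
∧-mono-≤ (b≤b {true})  q = q

∨-mono-≤ : ∀ {a b c d} → a ≤ b → c ≤ d → a ∨ c ≤ b ∨ d
∨-mono-≤ f≤t           _ = ≤-maximum _
∨-mono-≤ (b≤b {false}) q = q
∨-mono-≤ (b≤b {true})  _ = b≤b

≤false⇒≡false : ∀ {a} → a ≤ false → a ≡ false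
≤false⇒≡false b≤b = refl

true≤⇒≡true : ∀ {a} → true ≤ a → a ≡ true
true≤⇒≡true b≤b = refl

infix 4 _⊑_

_⊑_ : Vec Bool n → Vec Bool n → Set
_⊑_ = Pointwise _≤_

⊑-refl : x ⊑ x
⊑-refl = Pointwise.refl ≤-refl

[]≔-mono : ∀ i {a b} → a ≤ b → x ⊑ y → x [ i ]≔ a ⊑ y [ i ]≔ b
[]≔-mono zero    p (_ ∷ qs) = p ∷ qs
[]≔-mono (suc i) p (q ∷ qs) = q ∷ []≔-mono i p qs

[]≔-same : ∀ (v : Vec Bool n) i {a} → lookup v i ≡ a → v [ i ]≔ a ≡ v
[]≔-same v i refl = []≔-lookup v i

[]≔-lower : ∀ (v : Vec Bool n) i {a} → a ≤ lookup v i → v [ i ]≔ a ⊑ v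
[]≔-lower v i {a} p = subst (v [ i ]≔ a ⊑_) ([]≔-lookup v i) ([]≔-mono i p ⊑-refl)

[]≔-raise : ∀ (v : Vec Bool n) i {a} → lookup v i ≤ a → v ⊑ v [ i ]≔ a
[]≔-raise v i {a} p = subst (_⊑ v [ i ]≔ a) ([]≔-lookup v i) ([]≔-mono i p ⊑-refl)

-- Counting zeros.

zeros : Vec Bool n → ℕ
zeros []          = 0
zeros (false ∷ v) = suc (zeros v)
zeros (true  ∷ v) = zeros v

zeros-[]≔false : ∀ (v : Vec Bool n) i → lookup v i ≡ true →
                 zeros (v [ i ]≔ false) ≡ suc (zeros v)
zeros-[]≔false (_     ∷ v) zero    refl = refl
zeros-[]≔false (false ∷ v) (suc i) p    = cong suc (zeros-[]≔false v i p)
zeros-[]≔false (true  ∷ v) (suc i) p    = zeros-[]≔false v i p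

zeros-[]≔true : ∀ (v : Vec Bool n) i → lookup v i ≡ false →
                suc (zeros (v [ i ]≔ true)) ≡ zeros v
zeros-[]≔true (_     ∷ v) zero    refl = refl
zeros-[]≔true (false ∷ v) (suc i) p    = cong suc (zeros-[]≔true v i p)
zeros-[]≔true (true  ∷ v) (suc i) p    = zeros-[]≔true v i p

-- The zeros of a sorted vector fill an initial segment. With `sorted-true⇒zeros≤` this makes the
-- number of zeros a threshold that decides every entry.
sorted-false⇒<zeros : ∀ {v : Vec Bool n} → Linked _≤_ v → ∀ k →
                      lookup v k ≡ false → toℕ k < zeros v
sorted-false⇒<zeros {v = false ∷ v} s zero    p = s≤s z≤n
sorted-false⇒<zeros {v = false ∷ v} s (suc k) p =
  s≤s (sorted-false⇒<zeros (Linked.tail s) k p)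
-- A leading 1 would force a 1 on channel `suc k`, against `p`.
sorted-false⇒<zeros {v = true ∷ v}  s (suc k) p
  with () ← subst (true ≤_) p (Linked.lookup⁺ ≤-trans {i = zero} {j = suc k} s (s≤s z≤n))

sorted-true∷⇒zeros≡0 : ∀ {v : Vec Bool n} → Linked _≤_ (true ∷ v) → zeros v ≡ 0
sorted-true∷⇒zeros≡0 [-]                       = refl
sorted-true∷⇒zeros≡0 {v = true ∷ _} (b≤b ∷ s) = sorted-true∷⇒zeros≡0 s

sorted-true⇒zeros≤ : ∀ {v : Vec Bool n} → Linked _≤_ v → ∀ k →
                     lookup v k ≡ true → zeros v ≤ⁿ toℕ k
sorted-true⇒zeros≤ {v = true  ∷ v} s k       p =
  subst (_≤ⁿ toℕ k) (sym (sorted-true∷⇒zeros≡0 s)) z≤n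
sorted-true⇒zeros≤ {v = false ∷ v} s (suc k) p =
  s≤s (sorted-true⇒zeros≤ (Linked.tail s) k p)

-- The action of one comparator.

lo≢hi : (c : Comparator n) → lo c ≢ hi c
lo≢hi c = Fin.<⇒≢ (lo<hi c)

applyComparator-ordered : ∀ (v : Vec Bool n) c →
  lookup v (lo c) ≤ lookup v (hi c) → applyComparator v c ≡ v
applyComparator-ordered v c p with lookup v (lo c) | lookup v (hi c)
applyComparator-ordered v c f≤t | false | true  = refl
applyComparator-ordered v c b≤b | false | false = refl
applyComparator-ordered v c b≤b | true  | true  = refl

applyComparator-inverted : ∀ (v : Vec Bool n) c →
  lookup v (lo c) ≡ true → lookup v (hi c) ≡ false →
  applyComparator v c ≡ v [ lo c ]≔ false [ hi c ]≔ true
applyComparator-inverted v c p q rewrite p | q = refl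

-- Branch-free form of a comparator. Output values and monotonicity can be read off from `∧` and
-- `∨`, whereas the conditional swap may take different branches on two compared vectors.
minMax : Vec Bool n → Comparator n → Vec Bool n
minMax v c = v [ lo c ]≔ (lookup v (lo c) ∧ lookup v (hi c))
               [ hi c ]≔ (lookup v (lo c) ∨ lookup v (hi c))

applyComparator≡minMax : ∀ (v : Vec Bool n) c → applyComparator v c ≡ minMax v c
applyComparator≡minMax v c with lookup v (lo c) in p | lookup v (hi c) in q
... | true  | false = refl
... | false | false = sym (trans (cong (_[ hi c ]≔ _) ([]≔-same v (lo c) p)) ([]≔-same v (hi c) q))
... | false | true  = sym (trans (cong (_[ hi c ]≔ _) ([]≔-same v (lo c) p)) ([]≔-same v (hi c) q))
... | true  | true  = sym (trans (cong (_[ hi c ]≔ _) ([]≔-same v (lo c) p)) ([]≔-same v (hi c) q))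

applyComparator-lo : ∀ (v : Vec Bool n) c →
  lookup (applyComparator v c) (lo c) ≡ lookup v (lo c) ∧ lookup v (hi c)
applyComparator-lo v c rewrite applyComparator≡minMax v c =
  trans (lookup∘update′ (lo≢hi c) (v [ lo c ]≔ _) _) (lookup∘update (lo c) v _)

applyComparator-hi : ∀ (v : Vec Bool n) c →
  lookup (applyComparator v c) (hi c) ≡ lookup v (lo c) ∨ lookup v (hi c)
applyComparator-hi v c rewrite applyComparator≡minMax v c =
  lookup∘update (hi c) (v [ lo c ]≔ _) _

applyComparator-∉ : ∀ (v : Vec Bool n) c {k} → k ∉ channels c →
  lookup (applyComparator v c) k ≡ lookup v k
applyComparator-∉ v c k∉ rewrite applyComparator≡minMax v c =
  trans (lookup∘update′ (k∉ ∘ there ∘ here) (v [ lo c ]≔ _) _)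
        (lookup∘update′ (k∉ ∘ here) v _)

applyComparator-mono : ∀ (c : Comparator n) → x ⊑ y →
  applyComparator x c ⊑ applyComparator y c
applyComparator-mono {x = x} {y} c x⊑y =
  subst₂ _⊑_ (sym (applyComparator≡minMax x c)) (sym (applyComparator≡minMax y c))
    ([]≔-mono (hi c) (∨-mono-≤ (at (lo c)) (at (hi c)))
      ([]≔-mono (lo c) (∧-mono-≤ (at (lo c)) (at (hi c))) x⊑y))
  where at = Pointwise.lookup x⊑y

zeros-exchange : ∀ (v : Vec Bool n) {i j} → i ≢ j → lookup v i ≡ true → lookup v j ≡ false →
                 zeros (v [ i ]≔ false [ j ]≔ true) ≡ zeros v
-- Both counts are one below that of the intermediate vector `v [ i ]≔ false`.
zeros-exchange v {i} {j} i≢j p q = ℕ.suc-injective (trans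
  (zeros-[]≔true (v [ i ]≔ false) j (trans (lookup∘update′ (≢-sym i≢j) v _) q))
  (zeros-[]≔false v i p))

zeros-applyComparator : ∀ (v : Vec Bool n) c → zeros (applyComparator v c) ≡ zeros v
zeros-applyComparator v c with ≤-or-inverted (lookup v (lo c)) (lookup v (hi c))
... | inj₁ p       = cong zeros (applyComparator-ordered v c p)
... | inj₂ (p , q) = trans (cong zeros (applyComparator-inverted v c p q))
                           (zeros-exchange v (lo≢hi c) p q)

-- The action of one layer.

foldl-comparators-∉ : ∀ (v : Vec Bool n) cs {k} → All (λ c → k ∉ channels c) cs →
  lookup (foldl applyComparator v cs) k ≡ lookup v k
foldl-comparators-∉ v []       []         = refl
foldl-comparators-∉ v (c ∷ cs) (k∉ ∷ k∉s) =
  trans (foldl-comparators-∉ (applyComparator v c) cs k∉s) (applyComparator-∉ v c k∉)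

-- By disjointness no other comparator of the layer touches the channels of `c`: earlier ones
-- preserve its inputs, later ones its outputs.
foldl-comparators-∈ : ∀ (v : Vec Bool n) {cs c} →
  AllPairs (λ c d → Disjoint (channels c) (channels d)) cs → c ∈ cs →
  lookup (foldl applyComparator v cs) (lo c) ≡ lookup v (lo c) ∧ lookup v (hi c) ×
  lookup (foldl applyComparator v cs) (hi c) ≡ lookup v (lo c) ∨ lookup v (hi c)
foldl-comparators-∈ v {c ∷ cs} (c# ∷ _) (here refl) =
  trans (foldl-comparators-∉ _ cs (All.map (λ d# k∈ → d# (here refl , k∈)) c#))
        (applyComparator-lo v c) ,
  trans (foldl-comparators-∉ _ cs (All.map (λ d# k∈ → d# (there (here refl) , k∈)) c#))
        (applyComparator-hi v c)
foldl-comparators-∈ v {d ∷ cs} {c} (d# ∷ #s) (there c∈cs) =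
  trans (proj₁ rest) (cong₂ _∧_ lo≡ hi≡) , trans (proj₂ rest) (cong₂ _∨_ lo≡ hi≡)
  where
  rest = foldl-comparators-∈ (applyComparator v d) #s c∈cs
  c#d  = All.lookup d# c∈cs
  lo≡  = applyComparator-∉ v d (λ k∈ → c#d (k∈ , here refl))
  hi≡  = applyComparator-∉ v d (λ k∈ → c#d (k∈ , there (here refl)))

-- Invariants and monotonicity of runs.

module _ {A B : Set} {f : A → B → A} where

  foldl-invariant : (P : A → Set) → (∀ a b → P a → P (f a b)) →
                    ∀ bs {a} → P a → P (foldl f a bs)
  foldl-invariant P step []       p = p
  foldl-invariant P step (b ∷ bs) p = foldl-invariant P step bs (step _ b p)

  foldl-mono : (R : A → A → Set) → (∀ {a a′} b → R a a′ → R (f a b) (f a′ b)) →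
               ∀ bs {a a′} → R a a′ → R (foldl f a bs) (foldl f a′ bs)
  foldl-mono R step []       r = r
  foldl-mono R step (b ∷ bs) r = foldl-mono R step bs (step b r)

-- Reduces a property of runs to single comparators. It serves for the number of zeros, for the
-- fixed sorted vectors and for `Inverted`.
run-invariant : (P : Vec Bool n → Set) → (∀ v c → P v → P (applyComparator v c)) →
                ∀ C {v} → P v → P (run C v)
run-invariant P step = foldl-invariant P (λ _ L → foldl-invariant P step (comparators L))

run-mono : ∀ (C : Network n) → x ⊑ y → run C x ⊑ run C y
run-mono C = foldl-mono _⊑_ (λ L → foldl-mono _⊑_ applyComparator-mono (comparators L)) C

zeros-run : ∀ (C : Network n) v → zeros (run C v) ≡ zeros v
zeros-run C v = run-invariant (λ w → zeros w ≡ zeros v)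
  (λ w c → trans (zeros-applyComparator w c)) C refl

run-sorted : ∀ (C : Network n) {v} → Linked _≤_ v → run C v ≡ v
run-sorted C {v} s = run-invariant (_≡ v) step C refl
  where
  step : ∀ w c → w ≡ v → applyComparator w c ≡ v
  step _ c refl = applyComparator-ordered v c (Linked.lookup⁺ ≤-trans s (lo<hi c))

-- A comparator in the last layer of a sorting network.

module _ (B : Network n) (L : Layer n) (sorting : IsSorting (B ∷ʳ L))
         {c : Comparator n} (c∈L : c ∈ comparators L) where

  private
    i j : Fin n
    i = lo c
    j = hi c

  -- Phrased for an arbitrary input of `B`, so that the intermediate vectors and the output of a run
  -- can themselves be tested as inputs.
  Inverted : Vec Bool n → Set
  Inverted x = lookup (run B x) i ≡ true × lookup (run B x) j ≡ false

  module _ (x : Vec Bool n) where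

    private
      output : Vec Bool n
      output = run (B ∷ʳ L) x

      output-channels :
        lookup output i ≡ lookup (run B x) i ∧ lookup (run B x) j ×
        lookup output j ≡ lookup (run B x) i ∨ lookup (run B x) j
      output-channels rewrite foldl-∷ʳ applyLayer x L B =
        foldl-comparators-∈ (run B x) (disjoint L) c∈L

    false-min⇒lo<zeros : lookup (run B x) i ∧ lookup (run B x) j ≡ false → toℕ i < zeros x
    false-min⇒lo<zeros p = subst (toℕ i <_) (zeros-run (B ∷ʳ L) x)
      (sorted-false⇒<zeros (sorting x) i (trans (proj₁ output-channels) p))

    true-min⇒zeros≤lo : lookup (run B x) i ∧ lookup (run B x) j ≡ true → zeros x ≤ⁿ toℕ i
    true-min⇒zeros≤lo p = subst (_≤ⁿ toℕ i) (zeros-run (B ∷ʳ L) x)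
      (sorted-true⇒zeros≤ (sorting x) i (trans (proj₁ output-channels) p))

    false-max⇒hi<zeros : lookup (run B x) i ∨ lookup (run B x) j ≡ false → toℕ j < zeros x
    false-max⇒hi<zeros p = subst (toℕ j <_) (zeros-run (B ∷ʳ L) x)
      (sorted-false⇒<zeros (sorting x) j (trans (proj₂ output-channels) p))

    true-max⇒zeros≤hi : lookup (run B x) i ∨ lookup (run B x) j ≡ true → zeros x ≤ⁿ toℕ j
    true-max⇒zeros≤hi p = subst (_≤ⁿ toℕ j) (zeros-run (B ∷ʳ L) x)
      (sorted-true⇒zeros≤ (sorting x) j (trans (proj₂ output-channels) p))

  module _ (gap : suc (toℕ i) < toℕ j) where

    Inverted-transfer : ∀ {u x y v} → u ⊑ x → u ⊑ y → x ⊑ v → y ⊑ v →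
      zeros u ≡ suc (zeros x) → zeros y ≡ zeros x → suc (zeros v) ≡ zeros x →
      Inverted x → Inverted y
    Inverted-transfer {u} {x} {y} {v} u⊑x u⊑y x⊑v y⊑v zu zy zv (xi , xj)
      with lookup (run B y) i in yi | lookup (run B y) j in yj
    ... | true  | false = refl , refl
    -- Equal counts of zeros give `x` and `y` equal outputs, hence equal minima on `i` and equal
    -- maxima on `j`. This excludes two ones here and two zeros in the next case.
    ... | true  | true  = ⊥-elim (ℕ.<⇒≱ (false-min⇒lo<zeros x (cong₂ _∧_ xi xj))
      (subst (_≤ⁿ toℕ i) zy (true-min⇒zeros≤lo y (cong₂ _∧_ yi yj))))
    ... | false | false = ⊥-elim (ℕ.<⇒≱ (false-max⇒hi<zeros y (cong₂ _∨_ yi yj))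
      (subst (_≤ⁿ toℕ j) (sym zy) (true-max⇒zeros≤hi x (cong₂ _∨_ xi xj))))
    -- The counts for `u` and `v` differ by exactly two, yet `u` needs more than `j` zeros and `v`
    -- at most `i`. That forces `j` to be at most `i + 1`, against `gap`.
    ... | false | true  = ⊥-elim (ℕ.<⇒≱ gap (ℕ.≤-pred (begin
      suc (toℕ j)          ≤⟨ false-max⇒hi<zeros u (cong₂ _∨_ ui uj) ⟩
      zeros u              ≡⟨ trans zu (cong suc (sym zv)) ⟩
      suc (suc (zeros v))  ≤⟨ s≤s (s≤s (true-min⇒zeros≤lo v (cong₂ _∧_ vi vj))) ⟩
      suc (suc (toℕ i))    ∎)))
      where
      open ℕ.≤-Reasoning
      -- Below both `x` and `y`, `u` inherits the 0 of `y` on `i` and the 0 of `x` on `j`; dually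
      -- `v` inherits a 1 from each.
      ui = ≤false⇒≡false (subst (_ ≤_) yi (Pointwise.lookup (run-mono B u⊑y) i))
      uj = ≤false⇒≡false (subst (_ ≤_) xj (Pointwise.lookup (run-mono B u⊑x) j))
      vi = true≤⇒≡true (subst (_≤ _) xi (Pointwise.lookup (run-mono B x⊑v) i))
      vj = true≤⇒≡true (subst (_≤ _) yj (Pointwise.lookup (run-mono B y⊑v) j))

    Inverted-applyComparator : ∀ x d → Inverted x → Inverted (applyComparator x d)
    Inverted-applyComparator x d inv
      with ≤-or-inverted (lookup x (lo d)) (lookup x (hi d))
    ... | inj₁ p = subst Inverted (sym (applyComparator-ordered x d p)) inv
    ... | inj₂ (p , q) = subst Inverted (sym (applyComparator-inverted x d p q))
      -- Here `u` is `x` with the 1 on `lo d` lowered, `v` is `x` with the 0 on `hi d` raised, and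
      -- the swapped vector has both changes.
      (Inverted-transfer
        x↓⊑x
        ([]≔-raise (x [ lo d ]≔ false) (hi d) (≤-maximum _))
        ([]≔-raise x (hi d) (≤-maximum _))
        ([]≔-mono (hi d) ≤-refl x↓⊑x)
        (zeros-[]≔false x (lo d) p)
        (zeros-exchange x (lo≢hi d) p q)
        (zeros-[]≔true x (hi d) q)
        inv)
      where x↓⊑x = []≔-lower x (lo d) (≤-minimum _)

    ¬Inverted : ∀ x → ¬ Inverted x
    ¬Inverted x inv
      -- Following the run through all of `B ∷ʳ L` shows that its output, fed back into `B`, is
      -- still inverted.
      with p , q ← run-invariant Inverted Inverted-applyComparator (B ∷ʳ L) inv
      -- `B` fixes this sorted output, so the output itself would have 1 on `i` and 0 on `j`.
      with () ← subst₂ _≤_ p q (subst (λ w → lookup w i ≤ lookup w j)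
             (sym (run-sorted B (sorting x)))
             (Linked.lookup⁺ ≤-trans (sorting x) (lo<hi c)))

-- Links `last` with the indexing behind `Redundant`: the prefix it yields is the one that
-- `valuesBefore` runs.
last⇒∷ʳ : ∀ {A : Set} (xs : List A) {x} → last xs ≡ just x →
          ∃[ k ] layerAt xs k ≡ x × xs ≡ take (toℕ k) xs ∷ʳ x
last⇒∷ʳ (x ∷ [])         refl = zero , refl , refl
last⇒∷ʳ (x ∷ xs@(_ ∷ _)) p with k , at , split ← last⇒∷ʳ xs p =
  suc k , at , cong (x ∷_) split

lemma4 : ∀ (n : ℕ) (C : Network n) → IsNonRedundantSorting C →
    ∀ (L : Layer n) → last C ≡ just L →
    ∀ (c : Comparator n) → c ∈ comparators L → toℕ (hi c) ≡ suc (toℕ (lo c))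
lemma4 n C (sorting , nonRedundant) L last≡L c c∈L
  with toℕ (hi c) ℕ.≟ suc (toℕ (lo c)) | last⇒∷ʳ C last≡L
... | yes adjacent | _ = adjacent
... | no ¬adjacent | k , refl , split = ⊥-elim (nonRedundant k c c∈L redundant)
  where
  gap : suc (toℕ (lo c)) < toℕ (hi c)
  gap = ℕ.≤∧≢⇒< (lo<hi c) (≢-sym ¬adjacent)

  redundant : Redundant C k c
  redundant x with ≤-or-inverted (lookup (valuesBefore C k x) (lo c))
                                 (lookup (valuesBefore C k x) (hi c))
  ... | inj₁ p   = p
  -- With `take (toℕ k) C` as `B`, `run B x` is `valuesBefore C k x` by definition, so `inv` is
  -- already a proof of `Inverted x`.
  ... | inj₂ inv = ⊥-elim
    (¬Inverted (take (toℕ k) C) L (subst IsSorting split sorting) c∈L gap x inv)
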